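{- Suppose there exists a Hadamard matrix of order $n$. Then there exist a twin Deza graph with parameters $\left((2n-1)n,\ (n-1)n,\ \frac{n(n-1)}{2},\ \frac{n(n-2)}{2}\right)$, and a Siamese twin Deza reflexive graph with parameters $\left((2n-1)n,\ n^2,\ \frac{n(n+1)}{2},\ \frac{n^2}{2}\right)$.
   Context: A Hadamard matrix of order $n$ is an $n\times n$ $(1,-1)$-matrix $H$ with $HH^t=nI_n$. A Deza graph with parameters $(v,k,b,a)$, $a\le b$, is a $k$-regular simple graph on $v$ vertices such that any two distinct vertices have $a$ or $b$ common neighbours; equivalently its adjacency matrix $M$ is a symmetric $(0,1)$-matrix of order $v$ with zero diagonal, all row sums equal to $k$, and all off-diagonal entries of $M^2$ in $\{a,b\}$. A reflexive graph is obtained from a graph by including a loop at every vertex: if $A$ is the adjacency matrix of a graph on $v$ vertices, then $A+I_v$ is the adjacency matrix of the corresponding reflexive graph. A Deza reflexive graph with parameters $(v,k,b,a)$ is a reflexive graph on $v$ vertices whose adjacency matrix $M$ (symmetric, with all diagonal entries $1$) has all row sums equal to $k$ and all off-diagonal entries of $M^2$ in $\{a,b\}$. A $(0,\pm1)$-matrix $T$ is a twin Deza graph (with given parameters) if $T=K-L$, where $K,L$ are non-zero disjoint $(0,1)$-matrices and both $K$ and $L$ are adjacency matrices of Deza graphs with the same (given) parameters. Disjoint means that no two of the matrices have an entry $1$ in the same position. A $(0,\pm1)$-matrix $S$ is a Siamese twin Deza reflexive graph (with given parameters), sharing the entries of $N$, if $S=N+K-L$, where $N,K,L$ are non-zero disjoint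 $(0,1)$-matrices and both $N+K$ and $N+L$ are adjacency matrices of Deza reflexive graphs with the same (given) parameters.
   Formalization: The order n is assumed to be at least 2: for n = 1 the matrix (1) is Hadamard, but the parameters n(n-2)/2 and n²/2 are not integers and no non-zero 1×1 matrix with zero diagonal exists, so the claim fails there. -}

module Defs where

open import Data.Bool using (if_then_else_)
open import Data.Fin using (Fin; _≟_)
open import Data.Integer using (ℤ; +_; 0ℤ; 1ℤ; -1ℤ)
import Data.Integer as ℤ
open import Data.Integer.Properties using (+-0-commutativeMonoid)
open import Data.Nat using (ℕ; _≤_)
open import Data.Product using (_×_; ∃-syntax)
open import Data.Sum using (_⊎_)
open import Relation.Binary.PropositionalEquality using (_≡_; _≢_)
open import Relation.Nullary using (¬_; does)

open import Algebra.Properties.CommutativeMonoid.Sum +-0-commutativeMonoid using (sum)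

Matrix : ℕ → Set
Matrix n = Fin n → Fin n → ℤ

infix  4 _≈ᴹ_
infixl 6 _+ᴹ_ _-ᴹ_
infixl 7 _*ᴹ_ _·ᴹ_
infix  8 _ᵗ

_≈ᴹ_ : ∀ {n} → Matrix n → Matrix n → Set
A ≈ᴹ B = ∀ i j → A i j ≡ B i j

_+ᴹ_ _-ᴹ_ _*ᴹ_ : ∀ {n} → Matrix n → Matrix n → Matrix n
(A +ᴹ B) i j = A i j ℤ.+ B i j
(A -ᴹ B) i j = A i j ℤ.- B i j
(A *ᴹ B) i j = sum (λ l → A i l ℤ.* B l j)

_·ᴹ_ : ∀ {n} → ℤ → Matrix n → Matrix n
(c ·ᴹ A) i j = c ℤ.* A i j

_ᵗ : ∀ {n} → Matrix n → Matrix n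
(A ᵗ) i j = A j i

I : ∀ n → Matrix n
I n i j = if does (i ≟ j) then 1ℤ else 0ℤ

IsPlusMinusOne IsZeroOne IsZeroPlusMinusOne : ∀ {n} → Matrix n → Set
IsPlusMinusOne     A = ∀ i j → A i j ≡ 1ℤ ⊎ A i j ≡ -1ℤ
IsZeroOne          A = ∀ i j → A i j ≡ 0ℤ ⊎ A i j ≡ 1ℤ
IsZeroPlusMinusOne A = ∀ i j → A i j ≡ 0ℤ ⊎ A i j ≡ 1ℤ ⊎ A i j ≡ -1ℤ

IsSymmetric : ∀ {n} → Matrix n → Set
IsSymmetric A = A ᵗ ≈ᴹ A

NonZeroMatrix : ∀ {n} → Matrix n → Set
NonZeroMatrix A = ∃[ i ] ∃[ j ] A i j ≢ 0ℤ

Disjoint : ∀ {n} → Matrix n → Matrix n → Set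
Disjoint A B = ∀ i j → ¬ (A i j ≡ 1ℤ × B i j ≡ 1ℤ)

record IsHadamard {n : ℕ} (H : Matrix n) : Set where
  field
    ±1-entries : IsPlusMinusOne H
    HHᵗ≈nI     : H *ᴹ H ᵗ ≈ᴹ (+ n) ·ᴹ I n

-- Graphs are given by their adjacency matrices, and the parameters (v, k, b, a)
-- keep the customary order, with v the order of the matrix.  For distinct i and
-- j, entry (i , j) of M² counts the common neighbours of i and j.
record IsDezaGraph (v k b a : ℕ) (M : Matrix v) : Set where
  field
    a≤b          : a ≤ b
    zeroOne      : IsZeroOne M
    symmetric    : IsSymmetric M
    zeroDiagonal : ∀ i → M i i ≡ 0ℤ
    rowSums      : ∀ i → sum (M i) ≡ + k
    offDiagonal  : ∀ i j → i ≢ j → (M *ᴹ M) i j ≡ + a ⊎ (M *ᴹ M) i j ≡ + b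

-- The loop at each vertex contributes to the row sum k and to the entries of M².
record IsDezaReflexiveGraph (v k b a : ℕ) (M : Matrix v) : Set where
  field
    a≤b         : a ≤ b
    zeroOne     : IsZeroOne M
    symmetric   : IsSymmetric M
    oneDiagonal : ∀ i → M i i ≡ 1ℤ
    rowSums     : ∀ i → sum (M i) ≡ + k
    offDiagonal : ∀ i j → i ≢ j → (M *ᴹ M) i j ≡ + a ⊎ (M *ᴹ M) i j ≡ + b

record IsTwinDezaGraph (v k b a : ℕ) (T : Matrix v) : Set where
  field
    zeroPlusMinusOne : IsZeroPlusMinusOne T
    K L              : Matrix v
    T≈K-L            : T ≈ᴹ K -ᴹ L
    K-zeroOne        : IsZeroOne K
    L-zeroOne        : IsZeroOne L
    K-nonZero        : NonZeroMatrix K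
    L-nonZero        : NonZeroMatrix L
    K-L-disjoint     : Disjoint K L
    K-deza           : IsDezaGraph v k b a K
    L-deza           : IsDezaGraph v k b a L

record IsSiameseTwinDezaReflexiveGraph (v k b a : ℕ) (S : Matrix v) : Set where
  field
    zeroPlusMinusOne : IsZeroPlusMinusOne S
    N K L            : Matrix v
    S≈N+K-L          : S ≈ᴹ N +ᴹ K -ᴹ L
    N-zeroOne        : IsZeroOne N
    K-zeroOne        : IsZeroOne K
    L-zeroOne        : IsZeroOne L
    N-nonZero        : NonZeroMatrix N
    K-nonZero        : NonZeroMatrix K
    L-nonZero        : NonZeroMatrix L
    N-K-disjoint     : Disjoint N K
    N-L-disjoint     : Disjoint N L
    K-L-disjoint     : Disjoint K L
    N+K-deza         : IsDezaReflexiveGraph v k b a (N +ᴹ K)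
    N+L-deza         : IsDezaReflexiveGraph v k b a (N +ᴹ L)

{-# OPTIONS --safe #-}

-- Scale the rows of the Hadamard matrix H so that its column 0 is constant 1, and let
-- h₁, …, hₙ₋₁ be the other columns.  Since HᵗH = nI too, the rank-one matrices
-- Cᵢ = hᵢhᵢᵗ satisfy CᵢJ = 0, Cᵢ² = nCᵢ, CᵢCⱼ = 0 for i ≠ j, and ΣCᵢ = nI - J.
-- Index a (2n-1) × (2n-1) array of blocks by ℤ/(2n-1) and put Cᵢ in block (p , q)
-- whenever p - q = ±i, and 0 in the diagonal blocks; this is T.  In T² the block (p , q)
-- with p ≠ q collects only the products from those r with p - r = ±(r - q), so from
-- r = (p + q)/2 alone, and equals ±n entrywise; the diagonal blocks of T² are 2n(nI - J).
-- With K and L the positive and negative parts of T and N the diagonal blocks J, each of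
-- K, L, N + K, N + L is (1 + η[p = q] ± T)/2 with η = ∓1, so its square is determined by T².

module Submission where

open import Defs
open import Data.Product using (_×_; _,_; ∃-syntax; uncurry)
open import Relation.Binary.PropositionalEquality

module _ where

  open import Data.Bool using (if_then_else_)
  open import Data.Fin as Fin
    using (Fin; zero; suc; _≟_; toℕ; fromℕ<; splitAt; opposite; combine; remQuot; _↑ˡ_; _↑ʳ_)
  open import Data.Fin.Permutation using (Permutation′; permutation; reverse)
  open import Data.Fin.Properties
    using (toℕ-fromℕ<; toℕ-injective; toℕ<n; toℕ≤pred[n]; toℕ-↑ˡ; toℕ-↑ʳ; opposite-prop;
           splitAt-↑ˡ; splitAt-↑ʳ; splitAt⁻¹-↑ˡ; splitAt⁻¹-↑ʳ; punchInᵢ≢i;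
           remQuot-combine; combine-remQuot; ¬∀⟶∃¬)
  open import Data.Integer
    using (ℤ; +_; -[1+_]; 0ℤ; 1ℤ; -1ℤ; _+_; _*_; _-_; -_; _≤_; +≤+)
  import Data.Integer as ℤ
  open import Data.Integer.DivMod using (_%ℕ_; _/ℕ_; n%ℕd<d; a≡a%ℕn+[a/ℕn]*n)
  open import Data.Integer.Divisibility.Signed
    using (_∣_; divides; ∣⇒∣ᵤ; ∣m∣n⇒∣m+n; ∣m∣n⇒∣m-n; ∣n⇒∣m*n; ∣-refl; ∣m⇒∣-m)
  import Data.Integer.Properties as ℤ
  open import Data.Integer.Tactic.RingSolver using (solve-∀)
  open import Data.Nat as ℕ using (ℕ; zero; suc; z≤n; s≤s)
  import Data.Nat.Divisibility as ℕ
  import Data.Nat.DivMod as ℕ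
  import Data.Nat.Properties as ℕ
  open import Data.Sum as Sum using (_⊎_; inj₁; inj₂; [_,_]′)
  open import Function using (_∘_)
  open import Relation.Nullary using (¬_; yes; no; contradiction; does)
  open import Relation.Nullary.Decidable using (dec-true; dec-false)
  open import Algebra.Properties.CommutativeMonoid.Sum ℤ.+-0-commutativeMonoid
    using (sum; sum-cong-≗; sum-remove; sum-permute; ∑-distrib-+; ∑-comm)
  import Algebra.Properties.Semiring.Sum ℤ.+-*-semiring as Semiring
  open ≡-Reasoning

  -- Finite integer sums.

  *-distribˡ-sum : ∀ {n} c (f : Fin n → ℤ) → c * sum f ≡ sum (λ i → c * f i)
  *-distribˡ-sum = Semiring.*-distribˡ-sum

  *-distribʳ-sum : ∀ {n} c (f : Fin n → ℤ) → sum f * c ≡ sum (λ i → f i * c)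
  *-distribʳ-sum = Semiring.*-distribʳ-sum

  sum-zero : ∀ {n} {f : Fin n → ℤ} → (∀ i → f i ≡ 0ℤ) → sum f ≡ 0ℤ
  sum-zero {zero}  f≡0 = refl
  sum-zero {suc n} f≡0 = cong₂ _+_ (f≡0 zero) (sum-zero (f≡0 ∘ suc))

  sum-const : ∀ n (c : ℤ) → sum {n} (λ _ → c) ≡ + n * c
  sum-const zero    c = refl
  sum-const (suc n) c = trans (cong (λ s → c + s) (sum-const n c)) (sym (ℤ.suc-* (+ n) c))

  sum-single : ∀ {n} {f : Fin n → ℤ} i → (∀ j → j ≢ i → f j ≡ 0ℤ) → sum f ≡ f i
  sum-single {suc n} {f} i f≡0 = begin
    sum f        ≡⟨ sum-remove {i = i} f ⟩
    f i + _      ≡⟨ cong (λ s → f i + s) (sum-zero (λ j → f≡0 (Fin.punchIn i j) (punchInᵢ≢i i j))) ⟩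
    f i + 0ℤ     ≡⟨ ℤ.+-identityʳ (f i) ⟩
    f i          ∎

  sum-nonneg : ∀ {n} {f : Fin n → ℤ} → (∀ i → 0ℤ ≤ f i) → 0ℤ ≤ sum f
  sum-nonneg {zero}  0≤f = ℤ.≤-refl
  sum-nonneg {suc n} 0≤f = ℤ.+-mono-≤ (0≤f zero) (sum-nonneg (0≤f ∘ suc))

  sum-nonneg-≡0 : ∀ {n} {f : Fin n → ℤ} → (∀ i → 0ℤ ≤ f i) → sum f ≡ 0ℤ → ∀ i → f i ≡ 0ℤ
  sum-nonneg-≡0 {suc n} {f} 0≤f sum≡0 i = ℤ.≤-antisym f≤0 (0≤f i)
    where
    f≤0 : f i ≤ 0ℤ
    f≤0 = subst (f i ≤_) (trans (sym (sum-remove {i = i} f)) sum≡0)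
      (ℤ.i≤i+j (f i) _ ⦃ ℤ.nonNegative (sum-nonneg (0≤f ∘ Fin.punchIn i)) ⦄)

  sum-splitAt : ∀ k {n} (f : Fin (k ℕ.+ n) → ℤ) →
                sum f ≡ sum (λ i → f (i ↑ˡ n)) + sum (λ i → f (k ↑ʳ i))
  sum-splitAt zero    f = sym (ℤ.+-identityˡ (sum f))
  sum-splitAt (suc k) f =
    trans (cong (λ s → f zero + s) (sum-splitAt k (f ∘ suc))) (sym (ℤ.+-assoc (f zero) _ _))

  sum-combine : ∀ {m n} (f : Fin (m ℕ.* n) → ℤ) →
                sum f ≡ sum (λ p → sum (λ x → f (combine {m} p x)))
  sum-combine {zero}  f = refl
  sum-combine {suc m} {n} f = trans (sum-splitAt n f)
    (cong (λ s → sum (λ x → f (combine {suc m} zero x)) + s) (sum-combine {m} (λ i → f (n ↑ʳ i))))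

  -- Vertices are pairs (block, position) while matrices are indexed by `Fin (m * n)`; this passes
  -- from a sum over indices to a double sum over pairs.
  sum-remQuot : ∀ {m n} (f : Fin m × Fin n → ℤ) →
                sum (λ i → f (remQuot {m} n i)) ≡ sum (λ p → sum (λ x → f (p , x)))
  sum-remQuot {m} {n} f = trans (sum-combine {m} {n} (λ i → f (remQuot {m} n i)))
    (sum-cong-≗ λ p → sum-cong-≗ λ x → cong f (remQuot-combine p x))

  -- Signs and the identity matrix.

  i*i-nonneg : ∀ i → 0ℤ ≤ i * i
  i*i-nonneg (+ n)    = subst (0ℤ ≤_) (ℤ.pos-* n n) (+≤+ z≤n)
  i*i-nonneg -[1+ n ] = +≤+ z≤n

  ±1*±1≡1 : ∀ {i} → i ≡ 1ℤ ⊎ i ≡ -1ℤ → i * i ≡ 1ℤ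
  ±1*±1≡1 (inj₁ refl) = refl
  ±1*±1≡1 (inj₂ refl) = refl

  ±1-* : ∀ {i j} → i ≡ 1ℤ ⊎ i ≡ -1ℤ → j ≡ 1ℤ ⊎ j ≡ -1ℤ → i * j ≡ 1ℤ ⊎ i * j ≡ -1ℤ
  ±1-* (inj₁ refl) (inj₁ refl) = inj₁ refl
  ±1-* (inj₁ refl) (inj₂ refl) = inj₂ refl
  ±1-* (inj₂ refl) (inj₁ refl) = inj₂ refl
  ±1-* (inj₂ refl) (inj₂ refl) = inj₁ refl

  I-≡ : ∀ {n} (i : Fin n) → I n i i ≡ 1ℤ
  I-≡ i rewrite dec-true (i ≟ i) refl = refl

  I-≢ : ∀ {n} {i j : Fin n} → i ≢ j → I n i j ≡ 0ℤ
  I-≢ {i = i} {j} i≢j rewrite dec-false (i ≟ j) i≢j = refl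

  sum-I : ∀ {n} (f : Fin n → ℤ) i → sum (λ l → I n i l * f l) ≡ f i
  sum-I f i = trans (sum-single i λ j j≢i → cong (_* f j) (I-≢ (j≢i ∘ sym)))
    (trans (cong (_* f i) (I-≡ i)) (ℤ.*-identityˡ (f i)))

  -- Hadamard matrices: orthogonality of columns and normalisation.

  -- Put G = HᵗH.  From HHᵗ = nI one gets G² = nG, and G has diagonal entries n,
  -- so Σⱼ (Gᵢⱼ - nIᵢⱼ)² = (G²)ᵢᵢ - 2nGᵢᵢ + n² = 0.
  hadamard-columns : ∀ {n} {H : Matrix n} → IsHadamard H → H ᵗ *ᴹ H ≈ᴹ (+ n) ·ᴹ I n
  hadamard-columns {n} {H} hadamard i j =
    ℤ.i-j≡0⇒i≡j _ _ (Sum.reduce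
      (ℤ.i*j≡0⇒i≡0∨j≡0 (D j) (sum-nonneg-≡0 (λ l → i*i-nonneg (D l)) sumD²≡0 j)))
    where
    open IsHadamard hadamard
    N : ℤ
    N = + n
    G : Fin n → Fin n → ℤ
    G = H ᵗ *ᴹ H
    D : Fin n → ℤ
    D l = G i l - N * I n i l

    Gᵢᵢ≡n : G i i ≡ N
    Gᵢᵢ≡n = trans (sum-cong-≗ (λ z → ±1*±1≡1 (±1-entries z i)))
      (trans (sum-const n 1ℤ) (ℤ.*-identityʳ N))

    Gᵢₗ²≡ : ∀ l → G i l * G i l ≡ sum λ z → sum λ w → H z i * H w i * (H z l * H w l)
    Gᵢₗ²≡ l = begin
      G i l * G i l
        ≡⟨ *-distribʳ-sum (G i l) (λ z → H z i * H z l) ⟩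
      sum (λ z → H z i * H z l * G i l)
        ≡⟨ sum-cong-≗ (λ z → *-distribˡ-sum (H z i * H z l) (λ w → H w i * H w l)) ⟩
      sum (λ z → sum λ w → H z i * H z l * (H w i * H w l))
        ≡⟨ sum-cong-≗ (λ z → sum-cong-≗ λ w → rearrange (H z i) (H z l) (H w i) (H w l)) ⟩
      sum (λ z → sum λ w → H z i * H w i * (H z l * H w l)) ∎
      where
      rearrange : ∀ a b c d → a * b * (c * d) ≡ a * c * (b * d)
      rearrange = solve-∀

    sumG²≡n² : sum (λ l → G i l * G i l) ≡ N * N
    sumG²≡n² = begin
      sum (λ l → G i l * G i l)
        ≡⟨ sum-cong-≗ Gᵢₗ²≡ ⟩
      sum (λ l → sum λ z → sum λ w → H z i * H w i * (H z l * H w l))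
        ≡⟨ ∑-comm (λ l z → sum λ w → H z i * H w i * (H z l * H w l)) ⟩
      sum (λ z → sum λ l → sum λ w → H z i * H w i * (H z l * H w l))
        ≡⟨ sum-cong-≗ (λ z → ∑-comm (λ l w → H z i * H w i * (H z l * H w l))) ⟩
      -- With the sum over `l` innermost, an entry of HHᵗ splits off.
      sum (λ z → sum λ w → sum λ l → H z i * H w i * (H z l * H w l))
        ≡⟨ sum-cong-≗ (λ z → sum-cong-≗ λ w → sym (*-distribˡ-sum (H z i * H w i) (λ l → H z l * H w l))) ⟩
      sum (λ z → sum λ w → H z i * H w i * (H *ᴹ H ᵗ) z w)
        ≡⟨ sum-cong-≗ (λ z → sum-cong-≗ λ w →
             trans (cong (H z i * H w i *_) (HHᵗ≈nI z w)) (rearrange (H z i) (H w i) N (I n z w))) ⟩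
      sum (λ z → sum λ w → I n z w * (H z i * H w i * N))
        ≡⟨ sum-cong-≗ (λ z → trans (sum-I (λ w → H z i * H w i * N) z) (ℤ.*-comm _ N)) ⟩
      sum (λ z → N * (H z i * H z i))
        ≡⟨ *-distribˡ-sum N (λ z → H z i * H z i) ⟨
      N * G i i
        ≡⟨ cong (N *_) Gᵢᵢ≡n ⟩
      N * N ∎
      where
      rearrange : ∀ a b c d → a * b * (c * d) ≡ d * (a * b * c)
      rearrange = solve-∀

    sumD²≡0 : sum (λ l → D l * D l) ≡ 0ℤ
    sumD²≡0 = begin
      sum (λ l → D l * D l)
        ≡⟨ sum-cong-≗ (λ l → expand (G i l) (I n i l)) ⟩
      sum (λ l → G i l * G i l + I n i l * (I n i l * (N * N) - + 2 * N * G i l))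
        ≡⟨ ∑-distrib-+ (λ l → G i l * G i l) _ ⟩
      sum (λ l → G i l * G i l) + sum (λ l → I n i l * (I n i l * (N * N) - + 2 * N * G i l))
        ≡⟨ cong₂ _+_ sumG²≡n² (sum-I (λ l → I n i l * (N * N) - + 2 * N * G i l) i) ⟩
      N * N + (I n i i * (N * N) - + 2 * N * G i i)
        ≡⟨ cong₂ (λ a b → N * N + (a * (N * N) - + 2 * N * b)) (I-≡ i) Gᵢᵢ≡n ⟩
      N * N + (1ℤ * (N * N) - + 2 * N * N)
        ≡⟨ cancel N ⟩
      0ℤ ∎
      where
      cancel : ∀ a → a * a + (1ℤ * (a * a) - + 2 * a * a) ≡ 0ℤ
      cancel = solve-∀
      expand′ : ∀ a g d → (g - a * d) * (g - a * d) ≡ g * g + d * (d * (a * a) - + 2 * a * g)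
      expand′ = solve-∀
      expand : ∀ g d → (g - N * d) * (g - N * d) ≡ g * g + d * (d * (N * N) - + 2 * N * g)
      expand = expand′ N

  normalise : ∀ {h} → Matrix (suc h) → Matrix (suc h)
  normalise H x i = H x zero * H x i

  module _ {h : ℕ} {H : Matrix (suc h)} (hadamard : IsHadamard H) where
    open IsHadamard hadamard

    normalise-zero : ∀ x → normalise H x zero ≡ 1ℤ
    normalise-zero x = ±1*±1≡1 (±1-entries x zero)

    normalise-hadamard : IsHadamard (normalise H)
    normalise-hadamard = record
      { ±1-entries = λ x i → ±1-* (±1-entries x zero) (±1-entries x i)
      ; HHᵗ≈nI     = λ x y → begin
          sum (λ i → H x zero * H x i * (H y zero * H y i))
            ≡⟨ sum-cong-≗ (λ i → rearrange (H x zero) (H x i) (H y zero) (H y i)) ⟩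
          sum (λ i → H x zero * H y zero * (H x i * H y i))
            ≡⟨ *-distribˡ-sum (H x zero * H y zero) (λ i → H x i * H y i) ⟨
          H x zero * H y zero * (H *ᴹ H ᵗ) x y
            ≡⟨ cong (H x zero * H y zero *_) (HHᵗ≈nI x y) ⟩
          H x zero * H y zero * (+ suc h * I (suc h) x y)
            ≡⟨ scale x y ⟩
          + suc h * I (suc h) x y ∎
      }
      where
      rearrange : ∀ a b c d → a * b * (c * d) ≡ a * c * (b * d)
      rearrange = solve-∀
      -- On the diagonal the scaling factor is the square of a sign; off it both sides are 0.
      scale : ∀ x y → H x zero * H y zero * (+ suc h * I (suc h) x y) ≡ + suc h * I (suc h) x y
      scale x y with x ≟ y
      ... | yes refl = trans (cong (_* (+ suc h * 1ℤ)) (±1*±1≡1 (±1-entries x zero)))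
                         (ℤ.*-identityˡ (+ suc h * 1ℤ))
      ... | no  _    = trans (cong (H x zero * H y zero *_) (ℤ.*-zeroʳ (+ suc h)))
                         (trans (ℤ.*-zeroʳ (H x zero * H y zero)) (sym (ℤ.*-zeroʳ (+ suc h))))

  -- Residues modulo 2h + 1 up to sign, and the colouring of pairs of residues.

  ∣∧∣∣<⇒≡0 : ∀ {m z} → + m ∣ z → ℤ.∣ z ∣ ℕ.< m → z ≡ 0ℤ
  ∣∧∣∣<⇒≡0 {z = z} m∣z z<m with ℤ.∣ z ∣ in eq
  ... | zero  = ℤ.∣i∣≡0⇒i≡0 eq
  ... | suc k = contradiction (subst (_ ℕ.∣_) eq (∣⇒∣ᵤ m∣z)) (ℕ.>⇒∤ z<m)

  module Cyclic (h : ℕ) where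

    m : ℕ
    m = suc (h ℕ.+ h)

    M : ℤ
    M = + m

    M≡2h+1 : M ≡ 1ℤ + (+ h + + h)
    M≡2h+1 = cong (λ z → 1ℤ + z) (ℤ.pos-+ h h)

    -- The bound `k` is left open because residues in `Fin m` and their classes in `Fin (suc h)` are
    -- both read as integers.
    ⟦_⟧ : ∀ {k} → Fin k → ℤ
    ⟦ i ⟧ = + toℕ i

    ∣-cong : ∀ {z w} → z ≡ w → M ∣ z → M ∣ w
    ∣-cong = subst (M ∣_)

    residue : ℤ → Fin m
    residue z = fromℕ< (n%ℕd<d z m)

    ∣-residue : ∀ z → M ∣ z - ⟦ residue z ⟧
    ∣-residue z = divides (z /ℕ m) (begin
      z - ⟦ residue z ⟧                          ≡⟨ cong (λ r → z - + r) (toℕ-fromℕ< (n%ℕd<d z m)) ⟩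
      z - + (z %ℕ m)                             ≡⟨ cong (λ w → w - + (z %ℕ m)) (a≡a%ℕn+[a/ℕn]*n z m) ⟩
      + (z %ℕ m) + z /ℕ m * M - + (z %ℕ m)       ≡⟨ cancel (+ (z %ℕ m)) (z /ℕ m * M) ⟩
      z /ℕ m * M ∎)
      where
      cancel : ∀ a b → a + b - a ≡ b
      cancel = solve-∀

    ⟦⟧-injective : ∀ {i j : Fin m} → M ∣ ⟦ i ⟧ - ⟦ j ⟧ → i ≡ j
    ⟦⟧-injective {i} {j} m∣i-j = toℕ-injective (ℤ.+-injective (ℤ.i-j≡0⇒i≡j ⟦ i ⟧ ⟦ j ⟧ (∣∧∣∣<⇒≡0 m∣i-j i-j<m)))
      where
      i-j<m : ℤ.∣ ⟦ i ⟧ - ⟦ j ⟧ ∣ ℕ.< m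
      i-j<m = subst (λ z → ℤ.∣ z ∣ ℕ.< m) (sym (ℤ.m-n≡m⊖n (toℕ i) (toℕ j)))
        (ℕ.≤-<-trans (ℤ.∣m⊝n∣≤m⊔n (toℕ i) (toℕ j)) (ℕ.⊔-lub (toℕ<n i) (toℕ<n j)))

    infix 4 _∼_
    -- Congruence up to sign, z ≡ ±w modulo m, with the sign recorded by the constructor.
    data _∼_ (z w : ℤ) : Set where
      same     : M ∣ z - w → z ∼ w
      opposing : M ∣ z + w → z ∼ w

    ∼-sym : ∀ {z w} → z ∼ w → w ∼ z
    ∼-sym {z} {w} (same d) = same (∣-cong (lemma z w) (∣m⇒∣-m d))
      where
      lemma : ∀ a b → - (a - b) ≡ b - a
      lemma = solve-∀
    ∼-sym {z} {w} (opposing d) = opposing (∣-cong (ℤ.+-comm z w) d)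

    ∼-trans : ∀ {z w u} → z ∼ w → w ∼ u → z ∼ u
    ∼-trans {z} {w} {u} (same d) (same e) = same (∣-cong (lemma z w u) (∣m∣n⇒∣m+n d e))
      where
      lemma : ∀ a b c → a - b + (b - c) ≡ a - c
      lemma = solve-∀
    ∼-trans {z} {w} {u} (same d) (opposing e) = opposing (∣-cong (lemma z w u) (∣m∣n⇒∣m+n d e))
      where
      lemma : ∀ a b c → a - b + (b + c) ≡ a + c
      lemma = solve-∀
    ∼-trans {z} {w} {u} (opposing d) (same e) = opposing (∣-cong (lemma z w u) (∣m∣n⇒∣m-n d e))
      where
      lemma : ∀ a b c → a + b - (b - c) ≡ a + c
      lemma = solve-∀
    ∼-trans {z} {w} {u} (opposing d) (opposing e) = same (∣-cong (lemma z w u) (∣m∣n⇒∣m-n d e))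
      where
      lemma : ∀ a b c → a + b - (b + c) ≡ a - c
      lemma = solve-∀

    -- Both |i - j| and i + j are at most 2h < m, so divisibility by m forces the one in question to
    -- vanish, and i + j = 0 leaves only i = j = 0.
    ∼⇒≡ : ∀ {i j : Fin (suc h)} → ⟦ i ⟧ ∼ ⟦ j ⟧ → i ≡ j
    ∼⇒≡ {i} {j} = toℕ-injective ∘ λ { (same d) → minus d ; (opposing d) → plus d }
      where
      i+j<m : toℕ i ℕ.+ toℕ j ℕ.< m
      i+j<m = s≤s (ℕ.+-mono-≤ (toℕ≤pred[n] i) (toℕ≤pred[n] j))
      minus : M ∣ ⟦ i ⟧ - ⟦ j ⟧ → toℕ i ≡ toℕ j
      minus d = ℤ.+-injective (ℤ.i-j≡0⇒i≡j ⟦ i ⟧ ⟦ j ⟧ (∣∧∣∣<⇒≡0 d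
        (ℕ.≤-<-trans (ℤ.∣i-j∣≤∣i∣+∣j∣ ⟦ i ⟧ ⟦ j ⟧) i+j<m)))
      plus : M ∣ ⟦ i ⟧ + ⟦ j ⟧ → toℕ i ≡ toℕ j
      plus d = trans (ℕ.m+n≡0⇒m≡0 (toℕ i) i+j≡0) (sym (ℕ.m+n≡0⇒n≡0 (toℕ i) i+j≡0))
        where
        i+j≡0 : toℕ i ℕ.+ toℕ j ≡ 0
        i+j≡0 = ℤ.+-injective (∣∧∣∣<⇒≡0 d i+j<m)

    -- The representative in 0, ..., h of a residue up to sign: residues up to h are kept, and h + 1
    -- + i goes to its negative h - i, which is what `suc (opposite i)` computes.
    class : Fin m → Fin (suc h)
    class zero    = zero
    class (suc d) = suc ([ (λ i → i) , opposite ]′ (splitAt h d))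

    opposite-+ : ∀ {k} (i : Fin k) → ⟦ i ⟧ + ⟦ opposite i ⟧ + 1ℤ ≡ + k
    opposite-+ {k} i = cong +_ (begin
      toℕ i ℕ.+ toℕ (opposite i) ℕ.+ 1    ≡⟨ ℕ.+-comm _ 1 ⟩
      suc (toℕ i) ℕ.+ toℕ (opposite i)    ≡⟨ cong (suc (toℕ i) ℕ.+_) (opposite-prop i) ⟩
      suc (toℕ i) ℕ.+ (k ℕ.∸ suc (toℕ i)) ≡⟨ ℕ.m+[n∸m]≡n (toℕ<n i) ⟩
      k ∎)

    class-∼ : ∀ d → ⟦ d ⟧ ∼ ⟦ class d ⟧
    class-∼ zero    = same (divides 0ℤ refl)
    class-∼ (suc d) with splitAt h d in eq
    ... | inj₁ i = same (divides 0ℤ (ℤ.i≡j⇒i-j≡0 (cong (+_ ∘ suc) (begin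
            toℕ d         ≡⟨ cong toℕ (splitAt⁻¹-↑ˡ {m = h} {n = h} eq) ⟨
            toℕ (i ↑ˡ h)  ≡⟨ toℕ-↑ˡ i h ⟩
            toℕ i ∎))))
    -- Here residue and class add up to m exactly, hence the quotient 1.
    ... | inj₂ i = opposing (divides 1ℤ (begin
            + suc (toℕ d) + + suc (toℕ (opposite i))
              ≡⟨ cong (λ e → + suc e + + suc (toℕ (opposite i)))
                   (trans (cong toℕ (sym (splitAt⁻¹-↑ʳ {m = h} {n = h} eq))) (toℕ-↑ʳ h i)) ⟩
            1ℤ + (+ h + ⟦ i ⟧) + (1ℤ + ⟦ opposite i ⟧)
              ≡⟨ rearrange (+ h) ⟦ i ⟧ ⟦ opposite i ⟧ ⟩
            1ℤ + (+ h + (⟦ i ⟧ + ⟦ opposite i ⟧ + 1ℤ))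
              ≡⟨ cong (λ e → 1ℤ + (+ h + e)) (opposite-+ i) ⟩
            M
              ≡⟨ ℤ.*-identityˡ M ⟨
            1ℤ * M ∎))
      where
      rearrange : ∀ a b c → 1ℤ + (a + b) + (1ℤ + c) ≡ 1ℤ + (a + (b + c + 1ℤ))
      rearrange = solve-∀

    -- Class 0 has one residue and every other class has two. The residues 1, ..., h run through the
    -- nonzero classes in order, the remaining ones in reverse order.
    sum-class : ∀ (F : Fin (suc h) → ℤ) →
                sum (F ∘ class) ≡ F zero + (sum (F ∘ suc) + sum (F ∘ suc))
    sum-class F = cong (λ s → F zero + s) (trans (sum-splitAt h (λ d → F (class (suc d)))) (cong₂ _+_
      (sum-cong-≗ λ i → cong (F ∘ suc ∘ [ (λ i → i) , opposite ]′) (splitAt-↑ˡ h i h))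
      (trans (sum-cong-≗ λ i → cong (F ∘ suc ∘ [ (λ i → i) , opposite ]′) (splitAt-↑ʳ h h i))
             (sym (sum-permute (F ∘ suc) reverse)))))

    -- The index i with p - q ≡ ±i, which selects the matrix Cᵢ for block (p , q); colour 0 marks a
    -- zero block.
    colour : Fin m → Fin m → Fin (suc h)
    colour p q = class (residue (⟦ p ⟧ - ⟦ q ⟧))

    colour-∼ : ∀ p q → ⟦ p ⟧ - ⟦ q ⟧ ∼ ⟦ colour p q ⟧
    colour-∼ p q = ∼-trans (same (∣-residue (⟦ p ⟧ - ⟦ q ⟧))) (class-∼ _)

    colour-≡ : ∀ p q p′ q′ → ⟦ p ⟧ - ⟦ q ⟧ ∼ ⟦ p′ ⟧ - ⟦ q′ ⟧ → colour p q ≡ colour p′ q′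
    colour-≡ p q p′ q′ e = ∼⇒≡ (∼-trans (∼-sym (colour-∼ p q))
      (∼-trans e (colour-∼ p′ q′)))

    ≡-colour : ∀ p q p′ q′ → colour p q ≡ colour p′ q′ → ⟦ p ⟧ - ⟦ q ⟧ ∼ ⟦ p′ ⟧ - ⟦ q′ ⟧
    ≡-colour p q p′ q′ e = ∼-trans (colour-∼ p q)
      (subst (λ c → ⟦ c ⟧ ∼ ⟦ p′ ⟧ - ⟦ q′ ⟧) (sym e) (∼-sym (colour-∼ p′ q′)))

    colour-sym : ∀ p q → colour p q ≡ colour q p
    colour-sym p q = colour-≡ p q q p (opposing (divides 0ℤ (lemma ⟦ p ⟧ ⟦ q ⟧)))
      where
      lemma : ∀ a b → a - b + (b - a) ≡ 0ℤ
      lemma = solve-∀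

    colour-refl : ∀ p → colour p p ≡ zero
    colour-refl p = ∼⇒≡ (∼-sym (subst (_∼ ⟦ colour p p ⟧) (ℤ.+-inverseʳ ⟦ p ⟧) (colour-∼ p p)))

    colour≡zero⇒≡ : ∀ p q → colour p q ≡ zero → p ≡ q
    colour≡zero⇒≡ p q e with subst (λ c → ⟦ p ⟧ - ⟦ q ⟧ ∼ ⟦ c ⟧) e (colour-∼ p q)
    -- Compared with 0, either sign says that m divides p - q.
    ... | same d = ⟦⟧-injective (∣-cong (ℤ.+-identityʳ _) d)
    ... | opposing d = ⟦⟧-injective (∣-cong (ℤ.+-identityʳ _) d)

    -- h + 1 is the inverse of 2 modulo 2h + 1.
    midpoint : Fin m → Fin m → Fin m
    midpoint p q = residue ((⟦ p ⟧ + ⟦ q ⟧) * + suc h)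

    -- Twice the midpoint is congruent to (p + q)(2h + 2), and subtracting (p + q)(2h + 1), a
    -- multiple of m, leaves p + q.
    ∣-midpoint : ∀ p q → M ∣ ⟦ p ⟧ - ⟦ midpoint p q ⟧ - (⟦ midpoint p q ⟧ - ⟦ q ⟧)
    ∣-midpoint p q = ∣-cong
      (trans (cong (λ z → + 2 * ((⟦ p ⟧ + ⟦ q ⟧) * (1ℤ + + h) - ⟦ midpoint p q ⟧) - (⟦ p ⟧ + ⟦ q ⟧) * z) M≡2h+1)
             (lemma ⟦ p ⟧ ⟦ q ⟧ ⟦ midpoint p q ⟧ (+ h)))
      (∣m∣n⇒∣m-n (∣n⇒∣m*n (+ 2) (∣-residue ((⟦ p ⟧ + ⟦ q ⟧) * + suc h))) (∣n⇒∣m*n (⟦ p ⟧ + ⟦ q ⟧) ∣-refl))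
      where
      lemma : ∀ a b l k → + 2 * ((a + b) * (1ℤ + k) - l) - (a + b) * (1ℤ + (k + k)) ≡ a - l - (l - b)
      lemma = solve-∀

    colour-midpoint : ∀ p q → colour p (midpoint p q) ≡ colour (midpoint p q) q
    colour-midpoint p q = colour-≡ p (midpoint p q) (midpoint p q) q (same (∣-midpoint p q))

    -- If p - l ≡ l - q, comparison with the midpoint c gives 2(l - c) ≡ 0, and multiplication by h
    -- + 1 removes the 2. The opposite sign would give p ≡ q.
    midpoint-unique : ∀ {p q} l → p ≢ q → colour p l ≡ colour l q → l ≡ midpoint p q
    midpoint-unique {p} {q} l p≢q e with ≡-colour p l l q e
    ... | same d = ⟦⟧-injective (∣-cong
            (trans (cong (λ z → (1ℤ + + h) * (⟦ p ⟧ - c - (c - ⟦ q ⟧) - (⟦ p ⟧ - ⟦ l ⟧ - (⟦ l ⟧ - ⟦ q ⟧))) - (⟦ l ⟧ - c) * z) M≡2h+1)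
                   (lemma ⟦ p ⟧ ⟦ q ⟧ c ⟦ l ⟧ (+ h)))
            (∣m∣n⇒∣m-n (∣n⇒∣m*n (+ suc h) (∣m∣n⇒∣m-n (∣-midpoint p q) d)) (∣n⇒∣m*n (⟦ l ⟧ - c) ∣-refl)))
      where
      c : ℤ
      c = ⟦ midpoint p q ⟧
      lemma : ∀ a b c l k → (1ℤ + k) * (a - c - (c - b) - (a - l - (l - b))) - (l - c) * (1ℤ + (k + k)) ≡ l - c
      lemma = solve-∀
    ... | opposing d = contradiction (⟦⟧-injective (∣-cong (lemma ⟦ p ⟧ ⟦ l ⟧ ⟦ q ⟧) d)) p≢q
      where
      lemma : ∀ a l b → a - l + (l - b) ≡ a - b
      lemma = solve-∀

    -- The involution q ↦ p - q modulo m; it turns a sum over q of a function of p - q into a sum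
    -- over all residues.
    reflection : Fin m → Permutation′ m
    reflection p = permutation r r r∘r r∘r
      where
      r : Fin m → Fin m
      r q = residue (⟦ p ⟧ - ⟦ q ⟧)
      r∘r : ∀ q → r (r q) ≡ q
      r∘r q = ⟦⟧-injective (∣-cong (lemma ⟦ p ⟧ ⟦ q ⟧ ⟦ r q ⟧ ⟦ r (r q) ⟧)
        (∣m∣n⇒∣m-n (∣-residue (⟦ p ⟧ - ⟦ q ⟧)) (∣-residue (⟦ p ⟧ - ⟦ r q ⟧))))
        where
        lemma : ∀ a b c d → a - b - c - (a - c - d) ≡ d - b
        lemma = solve-∀

    sum-colour : ∀ (F : Fin (suc h) → ℤ) p →
                 sum (λ q → F (colour p q)) ≡ F zero + (sum (F ∘ suc) + sum (F ∘ suc))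
    sum-colour F p = trans (sym (sum-permute (F ∘ class) (reflection p))) (sum-class F)

  -- Halving, and the possible values of single entries.

  +-halve : ∀ {z k} → z + z ≡ + k → z ≡ + (k ℕ./ 2)
  -- A negative `z` cannot have the double `+ k`, so only this case remains.
  +-halve {+ n} refl = cong +_ (sym (trans (cong (ℕ._/ 2) (trans (cong (n ℕ.+_) (sym (ℕ.+-identityʳ n))) (ℕ.*-comm 2 n)))
    (ℕ.m*n/n≡m n 2)))

  +-double-injective : ∀ {z w} → z + z ≡ w + w → z ≡ w
  +-double-injective {z} {w} e = ℤ.*-cancelˡ-≡ (+ 2) z w (trans (double z) (trans e (sym (double w))))
    where
    double : ∀ z → + 2 * z ≡ z + z
    double = solve-∀

  sum≢0⇒∃ : ∀ {n} {f : Fin n → ℤ} → sum f ≢ 0ℤ → ∃[ i ] f i ≢ 0ℤ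
  sum≢0⇒∃ {n} {f} sum≢0 = ¬∀⟶∃¬ n (λ i → f i ≡ 0ℤ) (λ i → f i ℤ.≟ 0ℤ) (sum≢0 ∘ sum-zero)

  -- On entries of T the sign `ε` selects the positive part K (`1ℤ`) or the negative part L (`-1ℤ`).
  indicator : ℤ → ℤ → ℤ
  indicator ε t = if does (t ℤ.≟ ε) then 1ℤ else 0ℤ

  -- The values that [p = q] and the entry of T in block (p , q) take together.
  data Entry : ℤ → ℤ → Set where
    diagonal : Entry 1ℤ 0ℤ
    positive : Entry 0ℤ 1ℤ
    negative : Entry 0ℤ -1ℤ

  -- The indicator is (1 - δ + εt)/2; doubling keeps the computation in the integers. The
  -- coefficient `-1ℤ` of `δ` is written out because it is the value of η.
  entry-twice : ∀ {ε δ t} → ε ≡ 1ℤ ⊎ ε ≡ -1ℤ → Entry δ t →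
                indicator ε t + indicator ε t ≡ 1ℤ + -1ℤ * δ + ε * t
  entry-twice (inj₁ refl) diagonal = refl
  entry-twice (inj₁ refl) positive = refl
  entry-twice (inj₁ refl) negative = refl
  entry-twice (inj₂ refl) diagonal = refl
  entry-twice (inj₂ refl) positive = refl
  entry-twice (inj₂ refl) negative = refl

  entry-twice-reflexive : ∀ {ε δ t} → ε ≡ 1ℤ ⊎ ε ≡ -1ℤ → Entry δ t →
                          δ + indicator ε t + (δ + indicator ε t) ≡ 1ℤ + 1ℤ * δ + ε * t
  entry-twice-reflexive (inj₁ refl) diagonal = refl
  entry-twice-reflexive (inj₁ refl) positive = refl
  entry-twice-reflexive (inj₁ refl) negative = refl
  entry-twice-reflexive (inj₂ refl) diagonal = refl
  entry-twice-reflexive (inj₂ refl) positive = refl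
  entry-twice-reflexive (inj₂ refl) negative = refl

  indicator-zeroOne : ∀ ε t → indicator ε t ≡ 0ℤ ⊎ indicator ε t ≡ 1ℤ
  indicator-zeroOne ε t with t ℤ.≟ ε
  ... | yes _ = inj₂ refl
  ... | no  _ = inj₁ refl

  -- The blocks and the matrix T.

  module Construction {h : ℕ} {H : Matrix (suc h)} (hadamard : IsHadamard H)
                      (normalised : ∀ x → H x zero ≡ 1ℤ) where
    open Cyclic h
    open IsHadamard hadamard

    n : ℕ
    n = suc h

    N : ℤ
    N = + n

    M≡2N-1 : M ≡ N + N - 1ℤ
    M≡2N-1 = trans M≡2h+1 (lemma (+ h))
      where
      lemma : ∀ k → 1ℤ + (k + k) ≡ 1ℤ + k + (1ℤ + k) - 1ℤ
      lemma = solve-∀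

    -- Clearing the all-ones column makes the blocks of colour zero vanish.
    G : Fin n → Fin n → ℤ
    G x zero    = 0ℤ
    G x (suc i) = H x (suc i)

    G-±1 : ∀ x {i} → i ≢ zero → G x i ≡ 1ℤ ⊎ G x i ≡ -1ℤ
    G-±1 x {zero}  i≢0 = contradiction refl i≢0
    G-±1 x {suc i} _   = ±1-entries x (suc i)

    -- Row orthogonality of `H`, less the contribution 1 of the all-ones column.
    G-rows : ∀ x y → sum (λ i → G x (suc i) * G y (suc i)) ≡ N * I n x y - 1ℤ
    G-rows x y = begin
      S                                 ≡⟨ cancel S ⟩
      1ℤ * 1ℤ + S - 1ℤ                  ≡⟨ cong₂ (λ a b → a * b + S - 1ℤ) (normalised x) (normalised y) ⟨
      (H *ᴹ H ᵗ) x y - 1ℤ               ≡⟨ cong (λ s → s - 1ℤ) (HHᵗ≈nI x y) ⟩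
      N * I n x y - 1ℤ ∎
      where
      S : ℤ
      S = sum (λ i → H x (suc i) * H y (suc i))
      cancel : ∀ s → s ≡ 1ℤ * 1ℤ + s - 1ℤ
      cancel = solve-∀

    gram : Fin n → Fin n → ℤ
    gram i j = sum (λ z → G z i * G z j)

    -- Each later column of `H` is orthogonal to the all-ones column 0; this is CᵢJ = 0.
    G-columnSum : ∀ i → sum (λ z → G z i) ≡ 0ℤ
    G-columnSum zero    = sum-zero {n} (λ _ → refl)
    G-columnSum (suc i) = begin
      sum (λ z → H z (suc i))           ≡⟨ sum-cong-≗ (λ z → ℤ.*-identityˡ (H z (suc i))) ⟨
      sum (λ z → 1ℤ * H z (suc i))      ≡⟨ sum-cong-≗ (λ z → cong (_* H z (suc i)) (normalised z)) ⟨
      sum (λ z → H z zero * H z (suc i)) ≡⟨ hadamard-columns hadamard zero (suc i) ⟩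
      N * 0ℤ                            ≡⟨ ℤ.*-zeroʳ N ⟩
      0ℤ ∎

    gram-≢ : ∀ {i j} → i ≢ j → gram i j ≡ 0ℤ
    gram-≢ {zero}  {j}     _   = sum-zero {n} (λ z → ℤ.*-zeroˡ (G z j))
    gram-≢ {suc i} {zero}  _   = sum-zero {n} (λ z → ℤ.*-zeroʳ (H z (suc i)))
    gram-≢ {suc i} {suc j} i≢j = trans (hadamard-columns hadamard (suc i) (suc j))
      (trans (cong (N *_) (I-≢ i≢j)) (ℤ.*-zeroʳ N))

    -- This is Cᵢ² = nCᵢ. The factor `G x i * G y i` lets it hold for `i = zero` too, where
    -- `gram i i` is 0 rather than `N`.
    gram-≡ : ∀ x y i → G x i * G y i * gram i i ≡ N * (G x i * G y i)
    gram-≡ x y zero    = sym (ℤ.*-zeroʳ N)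
    gram-≡ x y (suc i) = begin
      c * gram (suc i) (suc i)  ≡⟨ cong (c *_) (hadamard-columns hadamard (suc i) (suc i)) ⟩
      c * (N * I n (suc i) (suc i)) ≡⟨ cong (λ d → c * (N * d)) (I-≡ (suc i)) ⟩
      c * (N * 1ℤ)              ≡⟨ cong (c *_) (ℤ.*-identityʳ N) ⟩
      c * N                     ≡⟨ ℤ.*-comm c N ⟩
      N * c ∎
      where
      c : ℤ
      c = G x (suc i) * G y (suc i)

    Vertex : Set
    Vertex = Fin m × Fin n

    block : Vertex → Vertex → ℤ
    block (p , _) (q , _) = I m p q

    T : Vertex → Vertex → ℤ
    T (p , x) (q , y) = G x (colour p q) * G y (colour p q)

    block-sym : ∀ u v → block u v ≡ block v u
    block-sym (p , _) (q , _) with p ≟ q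
    ... | yes refl = sym (I-≡ p)
    ... | no p≢q   = sym (I-≢ (p≢q ∘ sym))

    T-sym : ∀ u v → T u v ≡ T v u
    T-sym (p , x) (q , y) = trans (cong (λ c → G x c * G y c) (colour-sym p q))
      (ℤ.*-comm (G x (colour q p)) (G y (colour q p)))

    T-±1 : ∀ {p q} x y → p ≢ q → T (p , x) (q , y) ≡ 1ℤ ⊎ T (p , x) (q , y) ≡ -1ℤ
    T-±1 {p} {q} x y p≢q = ±1-* (G-±1 x c≢0) (G-±1 y c≢0)
      where
      c≢0 : colour p q ≢ zero
      c≢0 = p≢q ∘ colour≡zero⇒≡ p q

    entry : ∀ u v → Entry (block u v) (T u v)
    entry (p , x) (q , y) with p ≟ q
    ... | yes refl = subst (Entry 1ℤ) (sym (cong (λ c → G x c * G y c) (colour-refl p))) diagonal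
    ... | no p≢q with T-±1 x y p≢q
    ...   | inj₁ T≡1  = subst (Entry 0ℤ) (sym T≡1) positive
    ...   | inj₂ T≡-1 = subst (Entry 0ℤ) (sym T≡-1) negative

    entry-diagonal : ∀ {P : ℤ → ℤ → Set} u → P 1ℤ 0ℤ → P (block u u) (T u u)
    entry-diagonal {P} (p , x) base = subst₂ P (sym (I-≡ p)) (sym (cong (λ c → G x c * G x c) (colour-refl p))) base

    v : ℕ
    v = m ℕ.* n

    matrix : (Vertex → Vertex → ℤ) → Matrix v
    matrix P i j = P (remQuot n i) (remQuot n j)

    remQuot-injective : ∀ {i j : Fin v} → remQuot {m} n i ≡ remQuot n j → i ≡ j
    remQuot-injective {i} {j} e = trans (sym (combine-remQuot {m} n i))
      (trans (cong (uncurry combine) e) (combine-remQuot {m} n j))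

    -- Row sums and squares of a matrix P with 2P = 1 + η[p = q] + εT.

    module Signed {ε η : ℤ} (ε*ε≡1 : ε * ε ≡ 1ℤ) (η*η≡1 : η * η ≡ 1ℤ)
                  {P : Vertex → Vertex → ℤ}
                  (twice : ∀ u v → P u v + P u v ≡ 1ℤ + η * block u v + ε * T u v) where

      -- The part of 2P that is constant on each block; as a matrix of order m it is J + ηI.
      B : Fin m → Fin m → ℤ
      B p q = 1ℤ + η * I m p q

      sum-B : ∀ p → sum (B p) ≡ M + η
      sum-B p = begin
        sum (B p)
          ≡⟨ ∑-distrib-+ {m} (λ _ → 1ℤ) (λ q → η * I m p q) ⟩
        sum {m} (λ _ → 1ℤ) + sum (λ q → η * I m p q)
          ≡⟨ cong₂ _+_ (trans (sum-const m 1ℤ) (ℤ.*-identityʳ M))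
                       (trans (sum-cong-≗ λ q → ℤ.*-comm η (I m p q)) (sum-I (λ _ → η) p)) ⟩
        M + η ∎

      -- (J + ηI)² = mJ + 2ηJ + η²I, and η² = 1.
      sum-B*B : ∀ p q → sum (λ r → B p r * B r q) ≡ M + η + η + I m p q
      sum-B*B p q = begin
        sum (λ r → B p r * B r q)
          ≡⟨ sum-cong-≗ (λ r → trans (expand η (I m p r) (I m r q))
               (cong (λ e → I m p r * (η + e * I m r q) + (1ℤ + η * I m r q)) η*η≡1)) ⟩
        sum (λ r → I m p r * (η + 1ℤ * I m r q) + B r q)
          ≡⟨ ∑-distrib-+ (λ r → I m p r * (η + 1ℤ * I m r q)) (λ r → B r q) ⟩
        sum (λ r → I m p r * (η + 1ℤ * I m r q)) + sum (λ r → B r q)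
          ≡⟨ cong₂ _+_ (sum-I (λ r → η + 1ℤ * I m r q) p)
               (trans (sum-cong-≗ λ r → cong (λ e → 1ℤ + η * e) (block-sym (r , zero) (q , zero))) (sum-B q)) ⟩
        η + 1ℤ * I m p q + (M + η)
          ≡⟨ rearrange η (I m p q) M ⟩
        M + η + η + I m p q ∎
        where
        expand : ∀ e a b → (1ℤ + e * a) * (1ℤ + e * b) ≡ a * (e + e * e * b) + (1ℤ + e * b)
        expand = solve-∀
        rearrange : ∀ e a k → e + 1ℤ * a + (k + e) ≡ k + e + e + a
        rearrange = solve-∀

      sum-twice : ∀ p x → sum (λ r → sum λ z → P (p , x) (r , z) + P (p , x) (r , z)) ≡ N * (M + η)
      sum-twice p x = begin
        sum (λ r → sum λ z → P (p , x) (r , z) + P (p , x) (r , z))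
          ≡⟨ sum-cong-≗ inner ⟩
        sum (λ r → N * B p r)
          ≡⟨ *-distribˡ-sum N (B p) ⟨
        N * sum (B p)
          ≡⟨ cong (N *_) (sum-B p) ⟩
        N * (M + η) ∎
        where
        -- Within a block the column sums of `G` vanish, so only the constant part survives.
        inner : ∀ r → sum (λ z → P (p , x) (r , z) + P (p , x) (r , z)) ≡ N * B p r
        inner r = begin
          sum (λ z → P (p , x) (r , z) + P (p , x) (r , z))
            ≡⟨ sum-cong-≗ (λ z → trans (twice (p , x) (r , z))
                 (cong (λ e → B p r + e) (sym (ℤ.*-assoc ε (G x c) (G z c))))) ⟩
          sum (λ z → B p r + ε * G x c * G z c)
            ≡⟨ ∑-distrib-+ {n} (λ _ → B p r) (λ z → ε * G x c * G z c) ⟩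
          sum {n} (λ _ → B p r) + sum (λ z → ε * G x c * G z c)
            ≡⟨ cong₂ _+_ (sum-const n (B p r)) (sym (*-distribˡ-sum (ε * G x c) (λ z → G z c))) ⟩
          N * B p r + ε * G x c * sum (λ z → G z c)
            ≡⟨ cong (λ s → N * B p r + ε * G x c * s) (G-columnSum c) ⟩
          N * B p r + ε * G x c * 0ℤ
            ≡⟨ cong (λ s → N * B p r + s) (ℤ.*-zeroʳ (ε * G x c)) ⟩
          N * B p r + 0ℤ
            ≡⟨ ℤ.+-identityʳ (N * B p r) ⟩
          N * B p r ∎
          where
          c : Fin n
          c = colour p r

      rowSum : ∀ u → sum (λ r → sum λ z → P u (r , z)) + sum (λ r → sum λ z → P u (r , z)) ≡ N * (M + η)
      rowSum (p , x) = begin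
        sum R + sum R                   ≡⟨ ∑-distrib-+ R R ⟨
        sum (λ r → R r + R r)           ≡⟨ sum-cong-≗ (λ r → ∑-distrib-+ (λ z → P (p , x) (r , z)) (λ z → P (p , x) (r , z))) ⟨
        sum (λ r → sum λ z → P (p , x) (r , z) + P (p , x) (r , z)) ≡⟨ sum-twice p x ⟩
        N * (M + η) ∎
        where
        R : Fin m → ℤ
        R r = sum λ z → P (p , x) (r , z)

      -- Each of the two mixed terms contains a column sum of `G` and vanishes; the product of the
      -- two T-terms carries ε² = 1 and leaves an inner product of columns.
      blockProduct : ∀ β γ c d x y →
        sum (λ z → (β + ε * (G x c * G z c)) * (γ + ε * (G z d * G y d))) ≡
        N * (β * γ) + G x c * G y d * gram c d
      blockProduct β γ c d x y = begin
        sum (λ z → (β + ε * (G x c * G z c)) * (γ + ε * (G z d * G y d)))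
          ≡⟨ sum-cong-≗ (λ z → trans (expand β γ ε (G x c) (G z c) (G z d) (G y d))
               (cong (λ e → β * γ + (β * ε * G y d * G z d + (γ * ε * G x c * G z c
                 + e * (G x c * G y d * (G z c * G z d))))) ε*ε≡1)) ⟩
        sum (λ z → f₁ z + (f₂ z + (f₃ z + f₄ z)))
          ≡⟨ ∑-distrib-+ f₁ (λ z → f₂ z + (f₃ z + f₄ z)) ⟩
        sum f₁ + sum (λ z → f₂ z + (f₃ z + f₄ z))
          ≡⟨ cong (λ s → sum f₁ + s) (trans (∑-distrib-+ f₂ (λ z → f₃ z + f₄ z)) (cong (λ s → sum f₂ + s) (∑-distrib-+ f₃ f₄))) ⟩
        sum f₁ + (sum f₂ + (sum f₃ + sum f₄))
          ≡⟨ cong₂ _+_ (sum-const n (β * γ)) (cong₂ _+_ (vanish (β * ε * G y d) d) (cong₂ _+_ (vanish (γ * ε * G x c) c) last)) ⟩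
        N * (β * γ) + (0ℤ + (0ℤ + G x c * G y d * gram c d))
          ≡⟨ cong (λ s → N * (β * γ) + s) (trans (ℤ.+-identityˡ _) (ℤ.+-identityˡ _)) ⟩
        N * (β * γ) + G x c * G y d * gram c d ∎
        where
        f₁ f₂ f₃ f₄ : Fin n → ℤ
        f₁ z = β * γ
        f₂ z = β * ε * G y d * G z d
        f₃ z = γ * ε * G x c * G z c
        f₄ z = 1ℤ * (G x c * G y d * (G z c * G z d))
        vanish : ∀ k i → sum (λ z → k * G z i) ≡ 0ℤ
        vanish k i = trans (sym (*-distribˡ-sum k (λ z → G z i)))
          (trans (cong (k *_) (G-columnSum i)) (ℤ.*-zeroʳ k))
        last : sum f₄ ≡ G x c * G y d * gram c d
        last = trans (sum-cong-≗ λ z → ℤ.*-identityˡ (G x c * G y d * (G z c * G z d)))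
          (sym (*-distribˡ-sum (G x c * G y d) (λ z → G z c * G z d)))
        expand : ∀ b g e s t t′ s′ → (b + e * (s * t)) * (g + e * (t′ * s′)) ≡
                 b * g + (b * e * s′ * t′ + (g * e * s * t + e * e * (s * s′ * (t * t′))))
        expand = solve-∀

      -- The contribution of the blocks (p , r) and (r , q) to an entry of T², already summed over
      -- the positions inside block r.
      crossTerm : Vertex → Vertex → Fin m → ℤ
      crossTerm (p , x) (q , y) r = G x (colour p r) * G y (colour r q) * gram (colour p r) (colour r q)

      -- Blocks (p , r) and (r , p) share their colour, and each nonzero colour occurs for two
      -- values of r; summing over the colours leaves a product of two rows of `G`.
      crossTerm-diagonal : ∀ p x y → sum (crossTerm (p , x) (p , y)) ≡ + 2 * N * (N * I n x y - 1ℤ)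
      crossTerm-diagonal p x y = begin
        sum (crossTerm (p , x) (p , y))
          ≡⟨ sum-cong-≗ (λ r → trans
               (cong (λ d → G x (colour p r) * G y d * gram (colour p r) d) (colour-sym r p))
               (gram-≡ x y (colour p r))) ⟩
        sum (λ r → F (colour p r))
          ≡⟨ sum-colour F p ⟩
        N * 0ℤ + (sum (F ∘ suc) + sum (F ∘ suc))
          ≡⟨ cong (λ s → N * 0ℤ + (s + s)) (trans (sym (*-distribˡ-sum N (λ i → G x (suc i) * G y (suc i))))
               (cong (N *_) (G-rows x y))) ⟩
        N * 0ℤ + (N * (N * I n x y - 1ℤ) + N * (N * I n x y - 1ℤ))
          ≡⟨ double N (N * I n x y - 1ℤ) ⟩
        + 2 * N * (N * I n x y - 1ℤ) ∎
        where
        F : Fin n → ℤ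
        F i = N * (G x i * G y i)
        double : ∀ a b → a * 0ℤ + (a * b + a * b) ≡ + 2 * a * b
        double = solve-∀

      -- Columns of distinct colours are orthogonal, so only an r with equal colours on both sides
      -- contributes, and the midpoint is the only one.
      crossTerm-offDiagonal : ∀ {p q} x y → p ≢ q →
        sum (crossTerm (p , x) (q , y)) ≡ N * T (p , x) (midpoint p q , y)
      crossTerm-offDiagonal {p} {q} x y p≢q = begin
        sum (crossTerm (p , x) (q , y))
          ≡⟨ sum-single c (λ r r≢c → trans
               (cong (G x (colour p r) * G y (colour r q) *_) (gram-≢ (r≢c ∘ midpoint-unique r p≢q)))
               (ℤ.*-zeroʳ (G x (colour p r) * G y (colour r q)))) ⟩
        crossTerm (p , x) (q , y) c
          ≡⟨ cong (λ d → G x (colour p c) * G y d * gram (colour p c) d) (colour-midpoint p q) ⟨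
        G x (colour p c) * G y (colour p c) * gram (colour p c) (colour p c)
          ≡⟨ gram-≡ x y (colour p c) ⟩
        N * T (p , x) (c , y) ∎
        where
        c : Fin m
        c = midpoint p q

      -- This puts the surviving entry of T outside the diagonal blocks, where it is ±1. Were p the
      -- midpoint, both colours there would be 0, forcing p = q.
      p≢midpoint : ∀ {p q} → p ≢ q → p ≢ midpoint p q
      p≢midpoint {p} {q} p≢q p≡c = p≢q (colour≡zero⇒≡ p q
        (subst (λ r → colour r q ≡ zero) (sym p≡c)
          (trans (sym (colour-midpoint p q))
            (subst (λ r → colour p r ≡ zero) p≡c (colour-refl p)))))

      square : Vertex → Vertex → ℤ
      square u v = sum (λ r → sum λ z → P u (r , z) * P (r , z) v)

      -- Four times a product of entries is the product of the doubled entries, to which `twice`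
      -- applies. The 4 is split so that cancelling 2 leaves the double of the square.
      square-twice : ∀ p x q y → + 2 * (square (p , x) (q , y) + square (p , x) (q , y)) ≡
                     N * (M + η + η + I m p q) + sum (crossTerm (p , x) (q , y))
      square-twice p x q y = begin
        + 2 * (square (p , x) (q , y) + square (p , x) (q , y))
          ≡⟨ quadruple (square (p , x) (q , y)) ⟩
        + 4 * square (p , x) (q , y)
          ≡⟨ *-distribˡ-sum (+ 4) (λ r → sum λ z → P (p , x) (r , z) * P (r , z) (q , y)) ⟩
        sum (λ r → + 4 * sum λ z → P (p , x) (r , z) * P (r , z) (q , y))
          ≡⟨ sum-cong-≗ (λ r → *-distribˡ-sum (+ 4) (λ z → P (p , x) (r , z) * P (r , z) (q , y))) ⟩
        sum (λ r → sum λ z → + 4 * (P (p , x) (r , z) * P (r , z) (q , y)))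
          ≡⟨ sum-cong-≗ (λ r → sum-cong-≗ λ z →
               trans (product (P (p , x) (r , z)) (P (r , z) (q , y)))
                 (cong₂ _*_ (twice (p , x) (r , z)) (twice (r , z) (q , y)))) ⟩
        sum (λ r → sum λ z → (B p r + ε * T (p , x) (r , z)) * (B r q + ε * T (r , z) (q , y)))
          ≡⟨ sum-cong-≗ (λ r → blockProduct (B p r) (B r q) (colour p r) (colour r q) x y) ⟩
        sum (λ r → N * (B p r * B r q) + crossTerm (p , x) (q , y) r)
          ≡⟨ ∑-distrib-+ (λ r → N * (B p r * B r q)) (crossTerm (p , x) (q , y)) ⟩
        sum (λ r → N * (B p r * B r q)) + sum (crossTerm (p , x) (q , y))
          ≡⟨ cong (λ s → s + sum (crossTerm (p , x) (q , y))) (trans (sym (*-distribˡ-sum N (λ r → B p r * B r q)))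
               (cong (N *_) (sum-B*B p q))) ⟩
        N * (M + η + η + I m p q) + sum (crossTerm (p , x) (q , y)) ∎
        where
        quadruple : ∀ s → + 2 * (s + s) ≡ + 4 * s
        quadruple = solve-∀
        product : ∀ a b → + 4 * (a * b) ≡ (a + a) * (b + b)
        product = solve-∀

      square-offDiagonal : ∀ u v → u ≢ v →
        square u v + square u v ≡ N * (N + η - 1ℤ) ⊎ square u v + square u v ≡ N * (N + η)
      square-offDiagonal (p , x) (q , y) u≢v with p ≟ q
      -- Distinct vertices of one block have x ≠ y and always give the smaller value.
      ... | yes refl = inj₁ (ℤ.*-cancelˡ-≡ (+ 2) _ _ (begin
              + 2 * (square (p , x) (p , y) + square (p , x) (p , y))
                ≡⟨ square-twice p x p y ⟩
              N * (M + η + η + I m p p) + sum (crossTerm (p , x) (p , y))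
                ≡⟨ cong₂ _+_ (cong₂ (λ k d → N * (k + η + η + d)) M≡2N-1 (I-≡ p))
                     (trans (crossTerm-diagonal p x y)
                       (cong (λ d → + 2 * N * (N * d - 1ℤ)) (I-≢ (u≢v ∘ cong (p ,_))))) ⟩
              N * (N + N - 1ℤ + η + η + 1ℤ) + + 2 * N * (N * 0ℤ - 1ℤ)
                ≡⟨ simplify N η ⟩
              + 2 * (N * (N + η - 1ℤ)) ∎))
        where
        simplify : ∀ a e → a * (a + a - 1ℤ + e + e + 1ℤ) + + 2 * a * (a * 0ℤ - 1ℤ) ≡ + 2 * (a * (a + e - 1ℤ))
        simplify = solve-∀
      -- Between different blocks the entry of T at the midpoint decides; 1 gives the larger value,
      -- hence the swap.
      ... | no p≢q = Sum.swap (Sum.map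
              (λ T≡1 → ℤ.*-cancelˡ-≡ (+ 2) _ _ (trans (value T≡1) (plus N η)))
              (λ T≡-1 → ℤ.*-cancelˡ-≡ (+ 2) _ _ (trans (value T≡-1) (minus N η)))
              (T-±1 x y (p≢midpoint p≢q)))
        where
        value : ∀ {t} → T (p , x) (midpoint p q , y) ≡ t →
                + 2 * (square (p , x) (q , y) + square (p , x) (q , y)) ≡ N * (N + N - 1ℤ + η + η + 0ℤ) + N * t
        value T≡t = trans (square-twice p x q y)
          (cong₂ _+_ (cong₂ (λ k d → N * (k + η + η + d)) M≡2N-1 (I-≢ p≢q))
            (trans (crossTerm-offDiagonal x y p≢q) (cong (N *_) T≡t)))
        plus : ∀ a e → a * (a + a - 1ℤ + e + e + 0ℤ) + a * 1ℤ ≡ + 2 * (a * (a + e))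
        plus = solve-∀
        minus : ∀ a e → a * (a + a - 1ℤ + e + e + 0ℤ) + a * -1ℤ ≡ + 2 * (a * (a + e - 1ℤ))
        minus = solve-∀

      matrix-rowSum : ∀ i → sum (matrix P i) + sum (matrix P i) ≡ N * (M + η)
      matrix-rowSum i = subst (λ s → s + s ≡ N * (M + η))
        (sym (sum-remQuot {m} {n} (P (remQuot n i)))) (rowSum (remQuot n i))

      -- The doubled entries are `+ a` or `+ b`, so the divisions by 2 are exact in each case that
      -- occurs.
      matrix-square : ∀ {a b} → N * (N + η - 1ℤ) ≡ + a → N * (N + η) ≡ + b → ∀ i j → i ≢ j →
        (matrix P *ᴹ matrix P) i j ≡ + (a ℕ./ 2) ⊎ (matrix P *ᴹ matrix P) i j ≡ + (b ℕ./ 2)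
      matrix-square a≡ b≡ i j i≢j = Sum.map
        (λ s≡a → trans reindex (+-halve (trans s≡a a≡)))
        (λ s≡b → trans reindex (+-halve (trans s≡b b≡)))
        (square-offDiagonal (remQuot n i) (remQuot n j) (i≢j ∘ remQuot-injective))
        where
        reindex : (matrix P *ᴹ matrix P) i j ≡ square (remQuot n i) (remQuot n j)
        reindex = sum-remQuot {m} {n} (λ w → P (remQuot n i) w * P w (remQuot n j))

  -- Entrywise properties of N, K and L.

  entry-zeroPlusMinusOne : ∀ {δ t} → Entry δ t → t ≡ 0ℤ ⊎ t ≡ 1ℤ ⊎ t ≡ -1ℤ
  entry-zeroPlusMinusOne diagonal = inj₁ refl
  entry-zeroPlusMinusOne positive = inj₂ (inj₁ refl)
  entry-zeroPlusMinusOne negative = inj₂ (inj₂ refl)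

  entry-zeroPlusMinusOne-reflexive : ∀ {δ t} → Entry δ t → δ + t ≡ 0ℤ ⊎ δ + t ≡ 1ℤ ⊎ δ + t ≡ -1ℤ
  entry-zeroPlusMinusOne-reflexive diagonal = inj₂ (inj₁ refl)
  entry-zeroPlusMinusOne-reflexive positive = inj₂ (inj₁ refl)
  entry-zeroPlusMinusOne-reflexive negative = inj₂ (inj₂ refl)

  entry-difference : ∀ {δ t} → Entry δ t → t ≡ indicator 1ℤ t - indicator -1ℤ t
  entry-difference diagonal = refl
  entry-difference positive = refl
  entry-difference negative = refl

  entry-difference-reflexive : ∀ {δ t} → Entry δ t → δ + t ≡ δ + indicator 1ℤ t - indicator -1ℤ t
  entry-difference-reflexive diagonal = refl
  entry-difference-reflexive positive = refl
  entry-difference-reflexive negative = refl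

  entry-δ-zeroOne : ∀ {δ t} → Entry δ t → δ ≡ 0ℤ ⊎ δ ≡ 1ℤ
  entry-δ-zeroOne diagonal = inj₂ refl
  entry-δ-zeroOne positive = inj₁ refl
  entry-δ-zeroOne negative = inj₁ refl

  entry-zeroOne-reflexive : ∀ {ε δ t} → ε ≡ 1ℤ ⊎ ε ≡ -1ℤ → Entry δ t →
                            δ + indicator ε t ≡ 0ℤ ⊎ δ + indicator ε t ≡ 1ℤ
  entry-zeroOne-reflexive (inj₁ refl) diagonal = inj₂ refl
  entry-zeroOne-reflexive (inj₁ refl) positive = inj₂ refl
  entry-zeroOne-reflexive (inj₁ refl) negative = inj₁ refl
  entry-zeroOne-reflexive (inj₂ refl) diagonal = inj₂ refl
  entry-zeroOne-reflexive (inj₂ refl) positive = inj₁ refl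
  entry-zeroOne-reflexive (inj₂ refl) negative = inj₂ refl

  entry-disjoint : ∀ {δ t} → Entry δ t → ¬ (indicator 1ℤ t ≡ 1ℤ × indicator -1ℤ t ≡ 1ℤ)
  entry-disjoint diagonal (() , _)
  entry-disjoint positive (_ , ())
  entry-disjoint negative (() , _)

  entry-δ-disjoint : ∀ {ε δ t} → ε ≡ 1ℤ ⊎ ε ≡ -1ℤ → Entry δ t → ¬ (δ ≡ 1ℤ × indicator ε t ≡ 1ℤ)
  entry-δ-disjoint (inj₁ refl) diagonal (_ , ())
  entry-δ-disjoint (inj₂ refl) diagonal (_ , ())
  entry-δ-disjoint _           positive (() , _)
  entry-δ-disjoint _           negative (() , _)

  -- Assembling the twin and the Siamese twin.

  module Twins {k : ℕ} {H : Matrix (suc (suc k))} (hadamard : IsHadamard H)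
               (normalised : ∀ x → H x zero ≡ 1ℤ) where
    open Construction hadamard normalised
    open Cyclic (suc k) using (m; M)

    Part : ℤ → Vertex → Vertex → ℤ
    Part ε u w = indicator ε (T u w)

    ReflexivePart : ℤ → Vertex → Vertex → ℤ
    ReflexivePart ε u w = block u w + Part ε u w

    entries : ∀ i j → Entry (matrix block i j) (matrix T i j)
    entries i j = entry (remQuot n i) (remQuot n j)

    module _ {ε : ℤ} (ε≡±1 : ε ≡ 1ℤ ⊎ ε ≡ -1ℤ) where

      module Irreflexive = Signed {ε} { -1ℤ} (±1*±1≡1 ε≡±1) refl {Part ε}
        (λ u w → entry-twice ε≡±1 (entry u w))
      module Reflexive = Signed {ε} {1ℤ} (±1*±1≡1 ε≡±1) refl {ReflexivePart ε}
        (λ u w → entry-twice-reflexive ε≡±1 (entry u w))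

      part-symmetric : IsSymmetric (matrix (Part ε))
      part-symmetric i j = cong (indicator ε) (T-sym (remQuot n j) (remQuot n i))

      part-rowSum : ∀ i → sum (matrix (Part ε) i) ≡ + (suc k ℕ.* n)
      part-rowSum i = +-double-injective (begin
        _                        ≡⟨ Irreflexive.matrix-rowSum i ⟩
        N * (M + -1ℤ)            ≡⟨ cong (λ z → N * (z + -1ℤ)) M≡2N-1 ⟩
        -- `N` computes to `1ℤ + + suc k`, the form expected by `double`.
        N * (N + N - 1ℤ + -1ℤ)   ≡⟨ double (+ suc k) ⟩
        + suc k * N + + suc k * N ≡⟨ cong₂ _+_ (ℤ.pos-* (suc k) n) (ℤ.pos-* (suc k) n) ⟨
        + (suc k ℕ.* n) + + (suc k ℕ.* n) ∎)
        where
        double : ∀ a → (1ℤ + a) * (1ℤ + a + (1ℤ + a) - 1ℤ + -1ℤ) ≡ a * (1ℤ + a) + a * (1ℤ + a)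
        double = solve-∀

      part-deza : IsDezaGraph v (suc k ℕ.* n) (n ℕ.* suc k ℕ./ 2) (n ℕ.* k ℕ./ 2) (matrix (Part ε))
      part-deza = record
        { a≤b          = ℕ./-monoˡ-≤ 2 (ℕ.*-monoʳ-≤ n (ℕ.n≤1+n k))
        ; zeroOne      = λ i j → indicator-zeroOne ε (matrix T i j)
        ; symmetric    = part-symmetric
        ; zeroDiagonal = λ i → entry-diagonal {λ _ t → indicator ε t ≡ 0ℤ} (remQuot n i) (zero-diagonal ε≡±1)
        ; rowSums      = part-rowSum
        -- With η = -1 the doubled values are n(n - 2) and n(n - 1).
        ; offDiagonal  = Irreflexive.matrix-square
            (trans (cong (N *_) (minus-two (+ k))) (sym (ℤ.pos-* n k)))
            (trans (cong (N *_) (minus-one (+ suc k))) (sym (ℤ.pos-* n (suc k))))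
        }
        where
        zero-diagonal : ∀ {ε} → ε ≡ 1ℤ ⊎ ε ≡ -1ℤ → indicator ε 0ℤ ≡ 0ℤ
        zero-diagonal (inj₁ refl) = refl
        zero-diagonal (inj₂ refl) = refl
        minus-one : ∀ a → 1ℤ + a + -1ℤ ≡ a
        minus-one = solve-∀
        minus-two : ∀ a → 1ℤ + (1ℤ + a) + -1ℤ - 1ℤ ≡ a
        minus-two = solve-∀

      part-nonZero : NonZeroMatrix (matrix (Part ε))
      -- The row sum (n - 1)n is positive because the order is at least 2.
      part-nonZero = zero , sum≢0⇒∃ (λ sum≡0 → contradiction (trans (sym (part-rowSum zero)) sum≡0) λ ())

      +n^2≡N*N : + (n ℕ.^ 2) ≡ N * N
      +n^2≡N*N = trans (cong (λ e → + (n ℕ.* e)) (ℕ.*-identityʳ n)) (ℤ.pos-* n n)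

      reflexivePart-deza : IsDezaReflexiveGraph v (n ℕ.^ 2) (n ℕ.* (n ℕ.+ 1) ℕ./ 2) (n ℕ.^ 2 ℕ./ 2)
                             (matrix block +ᴹ matrix (Part ε))
      reflexivePart-deza = record
        { a≤b         = ℕ./-monoˡ-≤ 2 (ℕ.*-monoʳ-≤ n
                          (ℕ.≤-trans (ℕ.≤-reflexive (ℕ.*-identityʳ n)) (ℕ.m≤m+n n 1)))
        ; zeroOne     = λ i j → entry-zeroOne-reflexive ε≡±1 (entries i j)
        ; symmetric   = λ i j → cong₂ _+_ (block-sym (remQuot n j) (remQuot n i)) (part-symmetric i j)
        ; oneDiagonal = λ i → entry-diagonal {λ δ t → δ + indicator ε t ≡ 1ℤ} (remQuot n i) (one-diagonal ε≡±1)
        ; rowSums     = λ i → +-double-injective (begin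
            _                         ≡⟨ Reflexive.matrix-rowSum i ⟩
            N * (M + 1ℤ)              ≡⟨ cong (λ z → N * (z + 1ℤ)) M≡2N-1 ⟩
            N * (N + N - 1ℤ + 1ℤ)     ≡⟨ double N ⟩
            N * N + N * N             ≡⟨ cong₂ _+_ +n^2≡N*N +n^2≡N*N ⟨
            + (n ℕ.^ 2) + + (n ℕ.^ 2) ∎)
        -- With η = 1 the doubled values are n² and n(n + 1).
        ; offDiagonal = Reflexive.matrix-square
            (trans (cong (N *_) (cancel N)) (sym +n^2≡N*N))
            (sym (ℤ.pos-* n (n ℕ.+ 1)))
        }
        where
        one-diagonal : ∀ {ε} → ε ≡ 1ℤ ⊎ ε ≡ -1ℤ → 1ℤ + indicator ε 0ℤ ≡ 1ℤ
        one-diagonal (inj₁ refl) = refl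
        one-diagonal (inj₂ refl) = refl
        double : ∀ a → a * (a + a - 1ℤ + 1ℤ) ≡ a * a + a * a
        double = solve-∀
        cancel : ∀ a → a + 1ℤ - 1ℤ ≡ a
        cancel = solve-∀

    1≡±1 : 1ℤ ≡ 1ℤ ⊎ 1ℤ ≡ -1ℤ
    1≡±1 = inj₁ refl

    -1≡±1 : -1ℤ ≡ 1ℤ ⊎ -1ℤ ≡ -1ℤ
    -1≡±1 = inj₂ refl

    twin : IsTwinDezaGraph v (suc k ℕ.* n) (n ℕ.* suc k ℕ./ 2) (n ℕ.* k ℕ./ 2) (matrix T)
    twin = record
      { zeroPlusMinusOne = λ i j → entry-zeroPlusMinusOne (entries i j)
      ; K                = matrix (Part 1ℤ)
      ; L                = matrix (Part -1ℤ)
      ; T≈K-L            = λ i j → entry-difference (entries i j)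
      ; K-zeroOne        = λ i j → indicator-zeroOne 1ℤ (matrix T i j)
      ; L-zeroOne        = λ i j → indicator-zeroOne -1ℤ (matrix T i j)
      ; K-nonZero        = part-nonZero 1≡±1
      ; L-nonZero        = part-nonZero -1≡±1
      ; K-L-disjoint     = λ i j → entry-disjoint (entries i j)
      ; K-deza           = part-deza 1≡±1
      ; L-deza           = part-deza -1≡±1
      }

    siameseTwin : IsSiameseTwinDezaReflexiveGraph v (n ℕ.^ 2) (n ℕ.* (n ℕ.+ 1) ℕ./ 2) (n ℕ.^ 2 ℕ./ 2)
                    (matrix block +ᴹ matrix T)
    siameseTwin = record
      { zeroPlusMinusOne = λ i j → entry-zeroPlusMinusOne-reflexive (entries i j)
      ; N                = matrix block
      ; K                = matrix (Part 1ℤ)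
      ; L                = matrix (Part -1ℤ)
      ; S≈N+K-L          = λ i j → entry-difference-reflexive (entries i j)
      ; N-zeroOne        = λ i j → entry-δ-zeroOne (entries i j)
      ; K-zeroOne        = λ i j → indicator-zeroOne 1ℤ (matrix T i j)
      ; L-zeroOne        = λ i j → indicator-zeroOne -1ℤ (matrix T i j)
      -- Position (0, 0) lies in a diagonal block, so the entry computes to 1.
      ; N-nonZero        = zero , zero , λ ()
      ; K-nonZero        = part-nonZero 1≡±1
      ; L-nonZero        = part-nonZero -1≡±1
      ; N-K-disjoint     = λ i j → entry-δ-disjoint 1≡±1 (entries i j)
      ; N-L-disjoint     = λ i j → entry-δ-disjoint -1≡±1 (entries i j)
      ; K-L-disjoint     = λ i j → entry-disjoint (entries i j)
      ; N+K-deza         = reflexivePart-deza 1≡±1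
      ; N+L-deza         = reflexivePart-deza -1≡±1
      }

open import Data.Nat using (ℕ; suc; s≤s; _≤_; _*_; _∸_; _+_; _/_; _^_)
open import Data.Nat.Properties using (+-identityʳ; +-suc)

theorem4p1 : ∀ (n : ℕ) → 2 ≤ n →
    (∃[ H ] IsHadamard {n} H) →
    (∃[ T ] IsTwinDezaGraph ((2 * n ∸ 1) * n) ((n ∸ 1) * n)
    ((n * (n ∸ 1)) / 2) ((n * (n ∸ 2)) / 2) T)
    ×
    (∃[ S ] IsSiameseTwinDezaReflexiveGraph ((2 * n ∸ 1) * n) (n ^ 2)
    ((n * (n + 1)) / 2) ((n ^ 2) / 2) S)
theorem4p1 n@(suc h@(suc k)) (s≤s (s≤s _)) (H , hadamard) =
  -- Only the number of blocks, built as `suc (h + h)`, has to be rewritten; `n ∸ 1` and `n ∸ 2`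
  -- already compute to `h` and `k`.
  subst (λ m → (∃[ T ] IsTwinDezaGraph (m * n) (h * n) ((n * h) / 2) ((n * k) / 2) T)
             × (∃[ S ] IsSiameseTwinDezaReflexiveGraph (m * n) (n ^ 2)
                         ((n * (n + 1)) / 2) ((n ^ 2) / 2) S))
        m≡2n-1
        ((_ , twin) , (_ , siameseTwin))
  where
  open Twins (normalise-hadamard hadamard) (normalise-zero hadamard)
  m≡2n-1 : suc (h + h) ≡ 2 * n ∸ 1
  m≡2n-1 = sym (trans (cong (λ j → h + suc j) (+-identityʳ h)) (+-suc h h))
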